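{- Up to renaming of variables, the only minimally avoidable formula with exactly one fragment is $AA$.
   Context: Variables are letters of an alphabet $\Delta=\{A,B,C,\dots\}$. A formula is a finite set of non-empty words over $\Delta$, called fragments, written separated by dots; by convention every variable of a formula occurs at least twice in total (no isolated variable) and no fragment is a factor of another fragment. An occurrence of a formula $f$ in a word $w$ over an alphabet $\Sigma$ is a non-erasing morphism $h:\Delta^*\to\Sigma^*$ such that $h(\phi)$ is a factor of $w$ for every fragment $\phi$; $f$ is avoidable if for some finite alphabet there is an infinite word containing no occurrence of $f$, and unavoidable otherwise. Splitting a formula on a fragment $\phi$ means replacing $\phi$ by two fragments, namely the prefix and the suffix of $\phi$ of length $|\phi|-1$. A formula is minimally avoidable if it is avoidable and splitting it on any of its fragments yields an unavoidable formula. -}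

module Defs where

open import Data.Nat using (ℕ; _+_; _<_; _≤_; _∸_; _≟_)
open import Data.Fin using (Fin; fromℕ<)
open import Data.List using (List; []; _∷_; length; lookup; concatMap; take; drop; removeAt; filter; _++_)
open import Data.List.Relation.Unary.All using (All)
open import Data.List.Membership.Propositional using (_∈_)
open import Data.Product using (Σ; ∃; _×_)
open import Relation.Binary.PropositionalEquality using (_≡_; _≢_)
open import Relation.Nullary using (¬_)

Var : Set
Var = ℕ

Word : Set
Word = List Var

Formula : Set
Formula = List Word

InfWord : ℕ → Set
InfWord k = ℕ → Fin k

Factor : {k : ℕ} → List (Fin k) → InfWord k → Set
Factor u w = ∃ λ i → (j : ℕ) (p : j < length u) → w (i + j) ≡ lookup u (fromℕ< p)

-- A morphism Δ* → (Fin k)* is determined by images of the variables.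
Morphism : ℕ → Set
Morphism k = Var → List (Fin k)

NonErasing : {k : ℕ} → Morphism k → Set
NonErasing h = ∀ x → h x ≢ []

apply : {k : ℕ} → Morphism k → Word → List (Fin k)
apply h φ = concatMap h φ

Occurs : {k : ℕ} → Formula → InfWord k → Set
Occurs {k} f w = Σ (Morphism k) λ h → NonErasing h × All (λ φ → Factor (apply h φ) w) f

Avoidable : Formula → Set
Avoidable f = ∃ λ k → Σ (InfWord k) λ w → ¬ Occurs f w

Unavoidable : Formula → Set
Unavoidable f = ¬ Avoidable f

splitAt : (f : Formula) → Fin (length f) → Formula
splitAt f i = removeAt f i ++ (take (length φ ∸ 1) φ ∷ drop 1 φ ∷ [])
  where φ = lookup f i

MinimallyAvoidable : Formula → Set
MinimallyAvoidable f = Avoidable f × ((i : Fin (length f)) → Unavoidable (splitAt f i))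

occ : Var → Word → ℕ
occ x φ = length (filter (x ≟_) φ)

-- The one-fragment formula [ φ ] satisfies the conventions: φ is non-empty and
-- every variable of φ occurs at least twice (the no-factor condition is vacuous).
IsOneFragmentFormula : Word → Set
IsOneFragmentFormula φ = φ ≢ [] × (∀ x → x ∈ φ → 2 ≤ occ x φ)

{-# OPTIONS --safe #-}

-- A formula each of whose variables occurs twice in some fragment is avoided by
-- every word in which two occurrences of a factor of length m ≥ 1 are more than
-- c m apart, c being the length of its longest fragment: for a variable x whose
-- image u is longest, two copies of u inside the image of a fragment are at most
-- c |u| apart. Such a word has as its n-th letter n mod b and the last two base-b
-- digits of n without its trailing zeros. A repetition at distance d forces b ∣ d,
-- so d = q b^(k+1) with b ∤ q; a shift by d changes the last two digits of r in
-- n = r b^k, b ∤ r, and every window longer than 2 b^k contains such an n; hence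
-- b m ≤ 2 d.
--
-- If φ = A ψ B is longer than AA and each variable occurs twice in φ, then either
-- A = B does not occur in ψ, and ψ is avoidable by the above, or each variable of
-- the formula Aψ.ψB occurs twice in some fragment.
module Submission where

open import Defs
open import Data.List using (List; []; _∷_)
open import Data.Product using (∃; _×_)
open import Relation.Binary.PropositionalEquality using (_≡_)

open import Algebra.Properties.CommutativeSemigroup using (x∙yz≈y∙xz; xy∙z≈xz∙y; xy∙z≈y∙xz)
open import Data.Fin using (Fin; zero; suc; toℕ; fromℕ<; combine)
open import Data.Fin.Properties using (toℕ-fromℕ<; combine-injectiveˡ; combine-injectiveʳ)
open import Data.List using (length; lookup; filter; concat; map; take; initLast; _∷ʳ_; _∷ʳ′_; _++_; [_])
open import Data.List.Extrema.Nat using (argmax; argmax-all; f[xs]≤f[argmax]; max; xs≤max)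
open import Data.List.Membership.Propositional using (_∈_; _∉_; find)
open import Data.List.Membership.Propositional.Properties
  using (∈-++⁺ˡ; ∈-insert; ∈-concat⁺; ∈-concat⁻)
open import Data.List.Properties
  using ( length-++; length-++-≤ˡ; length-++-≤ʳ; concatMap-++; ++-identityʳ
        ; filter-++; filter-some; filter-accept; filter-reject)
open import Data.List.Relation.Unary.All as All using (All; []; _∷_)
open import Data.List.Relation.Unary.All.Properties using (++⁻ˡ; ++⁻ʳ; concat⁻; map⁺; map⁻)
open import Data.List.Relation.Unary.Any using (Any; here; there)
open import Data.Nat
  using ( ℕ; zero; suc; _+_; _*_; _^_; _≤_; _<_; _≟_; z≤n; s≤s; s≤s⁻¹; z<s
        ; NonZero; >-nonZero; ≢-nonZero
        ; NonTrivial; nonTrivial⇒nonZero; nonTrivial⇒n>1; nonTrivial⇒≢1)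
open import Data.List.Membership.DecPropositional _≟_ using (_∈?_)
open import Data.Nat.DivMod using (_/_; _%_; _mod_; m%n<n; m≡m%n+[m/n]*n; m/n*n≤m)
open import Data.Nat.Divisibility
  using ( _∣_; _∤_; _∣?_; divides; _∣0; m∣m*n; n∣m*n; ∣n⇒∣m*n; ∣m+n∣m⇒∣n; ∣1⇒≡1
        ; *-cancelʳ-∣)
open import Data.Nat.Induction using (Acc; acc; <-wellFounded)
open import Data.Nat.Properties
open import Data.Product using (Σ; _,_; proj₁; proj₂; ∃₂)
open import Function using (_∘_; id)
open import Relation.Binary.PropositionalEquality
  using (_≢_; refl; sym; trans; cong; subst; subst₂; module ≡-Reasoning)
open import Relation.Nullary using (¬_; yes; no; contradiction)

-- Words with widely spaced repetitions

Repeats : {A : Set} → (ℕ → A) → (i m d : ℕ) → Set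
Repeats w i m d = ∀ j → j < m → w (i + j) ≡ w (i + d + j)

Sparse : {k : ℕ} → ℕ → InfWord k → Set
Sparse c w = ∀ i m d → 0 < m → 0 < d → Repeats w i m d → c * m < d

mod≡⇒∣ : ∀ b .{{_ : NonZero b}} n d → n mod b ≡ (n + d) mod b → b ∣ d
mod≡⇒∣ b n d eq = ∣m+n∣m⇒∣n (divides ((n + d) / b) quotients) (n∣m*n (n / b))
  where
  open ≡-Reasoning

  remainders : n % b ≡ (n + d) % b
  remainders = begin
    n % b                  ≡⟨ toℕ-fromℕ< (m%n<n n b) ⟨
    toℕ (n mod b)          ≡⟨ cong toℕ eq ⟩
    toℕ ((n + d) mod b)    ≡⟨ toℕ-fromℕ< (m%n<n (n + d) b) ⟩
    (n + d) % b            ∎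

  quotients : n / b * b + d ≡ (n + d) / b * b
  quotients = +-cancelˡ-≡ (n % b) _ _ (begin
    n % b + (n / b * b + d)        ≡⟨ +-assoc (n % b) (n / b * b) d ⟨
    n % b + n / b * b + d          ≡⟨ cong (_+ d) (m≡m%n+[m/n]*n n b) ⟨
    n + d                          ≡⟨ m≡m%n+[m/n]*n (n + d) b ⟩
    (n + d) % b + (n + d) / b * b  ≡⟨ cong (_+ (n + d) / b * b) remainders ⟨
    n % b + (n + d) / b * b        ∎)

consecutive-multiples : ∀ g .{{_ : NonZero g}} i → ∃ λ q → i ≤ q * g × suc q * g ≤ i + 2 * g
consecutive-multiples g i = suc (i / g) , lower , upper
  where
  open ≤-Reasoning
  lower : i ≤ suc (i / g) * g
  lower = begin
    i                  ≡⟨ m≡m%n+[m/n]*n i g ⟩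
    i % g + i / g * g  ≤⟨ +-monoˡ-≤ (i / g * g) (<⇒≤ (m%n<n i g)) ⟩
    g + i / g * g      ∎

  upper : (2 + i / g) * g ≤ i + 2 * g
  upper = begin
    (2 + i / g) * g      ≡⟨ *-distribʳ-+ g 2 (i / g) ⟩
    2 * g + i / g * g    ≤⟨ +-monoʳ-≤ (2 * g) (m/n*n≤m i g) ⟩
    2 * g + i            ≡⟨ +-comm (2 * g) i ⟩
    i + 2 * g            ∎

module TrailingZeros (b : ℕ) .{{_ : NonTrivial b}} where

  instance
    b≢0 : NonZero b
    b≢0 = nonTrivial⇒nonZero b

    b*b≢0 : NonZero (b * b)
    b*b≢0 = m*n≢0 b b

  cofactor-exists : ∀ n → .{{NonZero n}} → ∃₂ λ k r → b ∤ r × n ≡ r * b ^ k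
  cofactor-exists n = go n (<-wellFounded n)
    where
    open ≡-Reasoning
    go : ∀ n → .{{NonZero n}} → Acc _<_ n → ∃₂ λ k r → b ∤ r × n ≡ r * b ^ k
    go n (acc smaller) with b ∣? n
    ... | no b∤n = 0 , n , b∤n , sym (*-identityʳ n)
    ... | yes (divides q@(suc _) refl)
      with k , r , b∤r , q≡ ← go q (smaller (m<m*n q b (nonTrivial⇒n>1 b)))
      = suc k , r , b∤r , (begin
        q * b            ≡⟨ cong (_* b) q≡ ⟩
        r * b ^ k * b    ≡⟨ *-assoc r (b ^ k) b ⟩
        r * (b ^ k * b)  ≡⟨ cong (r *_) (*-comm (b ^ k) b) ⟩
        r * b ^ suc k    ∎)

  cofactor-unique : ∀ k l {r s} → b ∤ r → b ∤ s → r * b ^ k ≡ s * b ^ l → r ≡ s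
  cofactor-unique zero    zero    _ _ eq = *-cancelʳ-≡ _ _ 1 eq
  cofactor-unique zero    (suc l) {r} {s} b∤r _ eq = contradiction b∣r b∤r
    where
    b∣r : b ∣ r
    b∣r = subst (b ∣_) (trans (sym eq) (*-identityʳ r)) (∣n⇒∣m*n s (m∣m*n (b ^ l)))
  cofactor-unique (suc k) zero    b∤r b∤s eq = sym (cofactor-unique zero (suc k) b∤s b∤r (sym eq))
  cofactor-unique (suc k) (suc l) {r} {s} b∤r b∤s eq = cofactor-unique k l b∤r b∤s
    (*-cancelˡ-≡ _ _ b (subst₂ _≡_ (b-first r k) (b-first s l) eq))
    where
    b-first : ∀ r k → r * b ^ suc k ≡ b * (r * b ^ k)
    b-first r k = x∙yz≈y∙xz *-commutativeSemigroup r b (b ^ k)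

  -- The value at 0 is arbitrary.
  strip : ℕ → ℕ
  strip zero      = zero
  strip n@(suc _) = proj₁ (proj₂ (cofactor-exists n))

  strip-*-^ : ∀ k {r} → b ∤ r → strip (r * b ^ k) ≡ r
  strip-*-^ k {r} b∤r with r * b ^ k in eq
  ... | zero = contradiction (divides 0 (m*n≡0⇒m≡0 r (b ^ k) {{m^n≢0 b k}} eq)) b∤r
  ... | n@(suc _) with l , s , b∤s , n≡ ← cofactor-exists n =
    sym (cofactor-unique k l b∤r b∤s (trans eq n≡))

  strip-mod-separates : ∀ k {r q} → b ∤ r → b ∤ q →
    strip (r * b ^ k) mod (b * b) ≢ strip (r * b ^ k + q * b ^ suc k) mod (b * b)
  strip-mod-separates k {r} {q} b∤r b∤q eq = b∤q (*-cancelʳ-∣ b (mod≡⇒∣ (b * b) r (q * b)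
    (subst₂ (λ m n → m mod (b * b) ≡ n mod (b * b)) (strip-*-^ k b∤r) strip-sum eq)))
    where
    open ≡-Reasoning
    b∤r+qb : b ∤ r + q * b
    b∤r+qb b∣ = b∤r (∣m+n∣m⇒∣n (subst (b ∣_) (+-comm r (q * b)) b∣) (n∣m*n q))

    strip-sum : strip (r * b ^ k + q * b ^ suc k) ≡ r + q * b
    strip-sum = begin
      strip (r * b ^ k + q * b ^ suc k)    ≡⟨ cong (λ m → strip (r * b ^ k + m)) (*-assoc q b (b ^ k)) ⟨
      strip (r * b ^ k + q * b * b ^ k)    ≡⟨ cong strip (*-distribʳ-+ (b ^ k) r (q * b)) ⟨
      strip ((r + q * b) * b ^ k)          ≡⟨ strip-*-^ k b∤r+qb ⟩
      r + q * b                            ∎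

  ∣⇒∤suc : ∀ {n} → b ∣ n → b ∤ suc n
  ∣⇒∤suc {n} b∣n b∣1+n =
    contradiction (∣1⇒≡1 (∣m+n∣m⇒∣n (subst (b ∣_) (+-comm 1 n) b∣1+n) b∣n)) nonTrivial⇒≢1

  ∃-∤-multiple : ∀ g .{{_ : NonZero g}} i → ∃ λ r → b ∤ r × i ≤ r * g × r * g ≤ i + 2 * g
  ∃-∤-multiple g i with q , i≤qg , qg+g≤i+2g ← consecutive-multiples g i | b ∣? q
  ... | no  b∤q = q , b∤q , i≤qg , ≤-trans (m≤n+m (q * g) g) qg+g≤i+2g
  ... | yes b∣q = suc q , ∣⇒∤suc b∣q , ≤-trans i≤qg (m≤n+m (q * g) g) , qg+g≤i+2g

  word : InfWord (b * (b * b))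
  word n = combine (n mod b) (strip n mod (b * b))

  word-≡⇒mod-≡ : ∀ m n → word m ≡ word n → m mod b ≡ n mod b
  word-≡⇒mod-≡ m n =
    combine-injectiveˡ (m mod b) (strip m mod (b * b)) (n mod b) (strip n mod (b * b))

  word-≡⇒strip-mod-≡ : ∀ m n → word m ≡ word n → strip m mod (b * b) ≡ strip n mod (b * b)
  word-≡⇒strip-mod-≡ m n =
    combine-injectiveʳ (m mod b) (strip m mod (b * b)) (n mod b) (strip n mod (b * b))

  repeats⇒b∣d : ∀ i m d → 0 < m → Repeats word i m d → b ∣ d
  repeats⇒b∣d i m d 0<m rep = mod≡⇒∣ b i d (word-≡⇒mod-≡ i (i + d)
    (subst₂ (λ n n′ → word n ≡ word n′) (+-identityʳ i) (+-identityʳ (i + d)) (rep 0 0<m)))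

  repeats⇒m≤2b^k : ∀ k {q} i m → b ∤ q → Repeats word i m (q * b ^ suc k) → m ≤ 2 * b ^ k
  repeats⇒m≤2b^k k {q} i m b∤q rep = ≮⇒≥ λ 2b^k<m →
    let r , j , b∤r , i+j≡rb^k , j≤2b^k = multiple-in-window
    in strip-mod-separates k b∤r b∤q (word-≡⇒strip-mod-≡ (r * b ^ k) (r * b ^ k + d)
         (subst (λ n → word n ≡ word (n + d)) i+j≡rb^k (shifted j (≤-<-trans j≤2b^k 2b^k<m))))
    where
    d : ℕ
    d = q * b ^ suc k

    multiple-in-window : ∃₂ λ r j → b ∤ r × i + j ≡ r * b ^ k × j ≤ 2 * b ^ k
    multiple-in-window
      with r , b∤r , i≤rb^k , rb^k≤ ← ∃-∤-multiple (b ^ k) {{m^n≢0 b k}} i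
      with j , i+j≡rb^k ← m≤n⇒∃[o]m+o≡n i≤rb^k =
      r , j , b∤r , i+j≡rb^k ,
      +-cancelˡ-≤ i _ _ (subst (_≤ i + 2 * b ^ k) (sym i+j≡rb^k) rb^k≤)

    shifted : ∀ j → j < m → word (i + j) ≡ word (i + j + d)
    shifted j j<m = trans (rep j j<m) (cong word (xy∙z≈xz∙y +-commutativeSemigroup i d j))

  repeats⇒bm≤2d : ∀ i m d → 0 < m → 0 < d → Repeats word i m d → b * m ≤ 2 * d
  repeats⇒bm≤2d i m d 0<m 0<d rep with cofactor-exists d {{>-nonZero 0<d}}
  ... | zero  , q , b∤q , refl =
    contradiction (subst (b ∣_) (*-identityʳ q) (repeats⇒b∣d i m (q * 1) 0<m rep)) b∤q
  ... | suc k , q , b∤q , refl = begin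
    b * m                ≤⟨ *-monoʳ-≤ b (repeats⇒m≤2b^k k i m b∤q rep) ⟩
    b * (2 * b ^ k)      ≡⟨ x∙yz≈y∙xz *-commutativeSemigroup b 2 (b ^ k) ⟩
    2 * b ^ suc k        ≤⟨ *-monoʳ-≤ 2 (m≤n*m (b ^ suc k) q {{q≢0}}) ⟩
    2 * (q * b ^ suc k)  ∎
    where
    open ≤-Reasoning
    q≢0 : NonZero q
    q≢0 = ≢-nonZero λ where refl → b∤q (b ∣0)

sparse-word : ∀ c → ∃ λ k → Σ (InfWord k) (Sparse c)
sparse-word c = _ , word , sparse
  where
  open TrailingZeros (suc c * 2)
  open ≤-Reasoning
  sparse : Sparse c word
  sparse i m d 0<m 0<d rep = *-cancelˡ-< 2 _ _ (begin-strict
    2 * (c * m)      <⟨ *-monoʳ-< 2 (*-monoˡ-< m {{>-nonZero 0<m}} (n<1+n c)) ⟩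
    2 * (suc c * m)  ≡⟨ xy∙z≈y∙xz *-commutativeSemigroup (suc c) 2 m ⟨
    suc c * 2 * m    ≤⟨ repeats⇒bm≤2d i m d 0<m 0<d rep ⟩
    2 * d            ∎)

-- Factors of infinite words

lookup-++ˡ : ∀ {a} {A : Set a} (u : List A) {v j} (p : j < length u) (q : j < length (u ++ v)) →
             lookup (u ++ v) (fromℕ< q) ≡ lookup u (fromℕ< p)
lookup-++ˡ (_ ∷ _) {j = zero}  _ _ = refl
lookup-++ˡ (_ ∷ u) {j = suc _} p q = lookup-++ˡ u (s≤s⁻¹ p) (s≤s⁻¹ q)

lookup-++ʳ : ∀ {a} {A : Set a} (u : List A) {v j} (p : j < length v)
             (q : length u + j < length (u ++ v)) →
             lookup (u ++ v) (fromℕ< q) ≡ lookup v (fromℕ< p)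
lookup-++ʳ []      _ _ = refl
lookup-++ʳ (_ ∷ u) p q = lookup-++ʳ u p (s≤s⁻¹ q)

FactorAt : {k : ℕ} → List (Fin k) → InfWord k → ℕ → Set
FactorAt u w i = ∀ j (p : j < length u) → w (i + j) ≡ lookup u (fromℕ< p)

module _ {k : ℕ} (w : InfWord k) where

  factorAt-++⁻ˡ : ∀ u {v i} → FactorAt (u ++ v) w i → FactorAt u w i
  factorAt-++⁻ˡ u {v} at j p = trans (at j q) (lookup-++ˡ u p q)
    where
    q : j < length (u ++ v)
    q = <-≤-trans p (length-++-≤ˡ u)

  factorAt-++⁻ʳ : ∀ u {v i} → FactorAt (u ++ v) w i → FactorAt v w (i + length u)
  factorAt-++⁻ʳ u {v} {i} at j p = begin
    w (i + length u + j)        ≡⟨ cong w (+-assoc i (length u) j) ⟩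
    w (i + (length u + j))      ≡⟨ at (length u + j) q ⟩
    lookup (u ++ v) (fromℕ< q)  ≡⟨ lookup-++ʳ u p q ⟩
    lookup v (fromℕ< p)         ∎
    where
    open ≡-Reasoning
    q : length u + j < length (u ++ v)
    q = subst (length u + j <_) (sym (length-++ u)) (+-monoʳ-< (length u) p)

  factor-++⁻ˡ : ∀ u {v} → Factor (u ++ v) w → Factor u w
  factor-++⁻ˡ u (i , at) = i , factorAt-++⁻ˡ u at

  factor-++⁻ʳ : ∀ u {v} → Factor (u ++ v) w → Factor v w
  factor-++⁻ʳ u (i , at) = i + length u , factorAt-++⁻ʳ u at

  sparse-gap : ∀ c → Sparse c w → ∀ u v {t} → 0 < length u →
               Factor ((u ++ v) ++ u ++ t) w → c * length u < length (u ++ v)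
  sparse-gap c sparse u v 0<|u| (i , at) =
    sparse i (length u) (length (u ++ v)) 0<|u| (<-≤-trans 0<|u| (length-++-≤ˡ u))
      λ j p → trans (first j p) (sym (second j p))
    where
    first : FactorAt u w i
    first = factorAt-++⁻ˡ u (factorAt-++⁻ˡ (u ++ v) at)

    second : FactorAt u w (i + length (u ++ v))
    second = factorAt-++⁻ˡ u (factorAt-++⁻ʳ (u ++ v) at)

apply-++-++ : ∀ {k} (h : Morphism k) α φ β →
              apply h (α ++ φ ++ β) ≡ apply h α ++ apply h φ ++ apply h β
apply-++-++ h α φ β =
  trans (concatMap-++ h α (φ ++ β)) (cong (apply h α ++_) (concatMap-++ h φ β))

avoidable-infix : ∀ {f g} → (∀ {φ} → φ ∈ g → ∃₂ λ α β → α ++ φ ++ β ∈ f) → Avoidable g → Avoidable f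
avoidable-infix {f} {g} infix-of (k , w , avoids) = k , w , λ (h , h≢[] , occurs) →
  avoids (h , h≢[] , All.tabulate (factor h occurs))
  where
  factor : ∀ h → All (λ χ → Factor (apply h χ) w) f → ∀ {φ} → φ ∈ g → Factor (apply h φ) w
  factor h occurs {φ} φ∈g with α , β , αφβ∈f ← infix-of φ∈g =
    factor-++⁻ˡ w (apply h φ) (factor-++⁻ʳ w (apply h α)
      (subst (λ u → Factor u w) (apply-++-++ h α φ β) (All.lookup occurs αφβ∈f)))

singletons-unavoidable : ∀ xs → Unavoidable (map [_] xs)
singletons-unavoidable xs (k , w , avoids) =
  avoids ((λ _ → [ w 0 ]) , (λ _ ()) , map⁺ (All.universal (λ _ → 0 , first-letter) xs))
  where
  first-letter : FactorAt [ w 0 ] w 0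
  first-letter zero    _         = refl
  first-letter (suc _) (s≤s ())

-- Occurrences of a variable in a word

occ-∷-≡ : ∀ x φ → occ x (x ∷ φ) ≡ suc (occ x φ)
occ-∷-≡ x φ = cong length (filter-accept (x ≟_) {xs = φ} refl)

occ-∷-≢ : ∀ {x y} φ → x ≢ y → occ x (y ∷ φ) ≡ occ x φ
occ-∷-≢ {x} φ x≢y = cong length (filter-reject (x ≟_) {xs = φ} x≢y)

occ-∷ʳ-≢ : ∀ {x y} φ → x ≢ y → occ x (φ ∷ʳ y) ≡ occ x φ
occ-∷ʳ-≢ {x} {y} φ x≢y = cong length (begin
  filter (x ≟_) (φ ∷ʳ y)                    ≡⟨ filter-++ (x ≟_) φ [ y ] ⟩
  filter (x ≟_) φ ++ filter (x ≟_) [ y ]    ≡⟨ cong (filter (x ≟_) φ ++_) (filter-reject (x ≟_) x≢y) ⟩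
  filter (x ≟_) φ ++ []                     ≡⟨ ++-identityʳ (filter (x ≟_) φ) ⟩
  filter (x ≟_) φ                           ∎)
  where open ≡-Reasoning

split-at-first : ∀ {n} x φ → suc n ≤ occ x φ → ∃₂ λ α β → φ ≡ α ++ x ∷ β × n ≤ occ x β
split-at-first x (y ∷ φ) n< with x ≟ y
... | yes refl = [] , φ , refl , s≤s⁻¹ (subst (_ ≤_) (occ-∷-≡ x φ) n<)
... | no  x≢y  with α , β , refl , n≤ ← split-at-first x φ (subst (_ ≤_) (occ-∷-≢ φ x≢y) n<) =
  y ∷ α , β , refl , n≤

1≤occ⇒∈ : ∀ x φ → 1 ≤ occ x φ → x ∈ φ
1≤occ⇒∈ x φ 1≤ with α , _ , refl , _ ← split-at-first x φ 1≤ = ∈-insert α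

2≤occ⇒++ : ∀ x φ → 2 ≤ occ x φ → ∃₂ λ α β → ∃ λ γ → φ ≡ α ++ x ∷ β ++ x ∷ γ
2≤occ⇒++ x φ 2≤
  with α , ψ , refl , 1≤ ← split-at-first x φ 2≤
  with β , γ , refl , _  ← split-at-first x ψ 1≤ = α , β , γ , refl

2≤occ-∷⇒∈ : ∀ x φ → 2 ≤ occ x (x ∷ φ) → x ∈ φ
2≤occ-∷⇒∈ x φ 2≤ = 1≤occ⇒∈ x φ (s≤s⁻¹ (subst (2 ≤_) (occ-∷-≡ x φ) 2≤))

∈⇒2≤occ-∷ : ∀ x φ → x ∈ φ → 2 ≤ occ x (x ∷ φ)
∈⇒2≤occ-∷ x φ x∈φ = subst (2 ≤_) (sym (occ-∷-≡ x φ)) (s≤s (filter-some (x ≟_) x∈φ))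

-- Doubled formulas

0<length : ∀ {a} {A : Set a} {u : List A} → u ≢ [] → 0 < length u
0<length {u = []}    u≢[] = contradiction refl u≢[]
0<length {u = _ ∷ _} _    = z<s

length-apply-≤ : ∀ {k} (h : Morphism k) {m} φ → All (λ y → length (h y) ≤ m) φ →
                 length (apply h φ) ≤ length φ * m
length-apply-≤ h []      []          = z≤n
length-apply-≤ h (y ∷ φ) (y≤m ∷ φ≤m) =
  ≤-trans (≤-reflexive (length-++ (h y))) (+-mono-≤ y≤m (length-apply-≤ h φ φ≤m))

longest-image-not-repeated : ∀ {k x φ} c (w : InfWord k) (h : Morphism k) → Sparse c w → NonErasing h →
  All (λ y → length (h y) ≤ length (h x)) φ → length φ ≤ c → 2 ≤ occ x φ → ¬ Factor (apply h φ) w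
longest-image-not-repeated {x = x} {φ} c w h sparse h≢[] longest |φ|≤c 2≤ factor
  with α , β , γ , refl ← 2≤occ⇒++ x φ 2≤ = <-irrefl refl (begin-strict
    c * length (h x)               <⟨ sparse-gap w c sparse (h x) (apply h β) (0<length (h≢[] x)) copies ⟩
    length (apply h (x ∷ β))       ≤⟨ length-apply-≤ h (x ∷ β) (++⁻ˡ (x ∷ β) (++⁻ʳ α longest)) ⟩
    length (x ∷ β) * length (h x)  ≤⟨ *-monoˡ-≤ (length (h x)) |xβ|≤c ⟩
    c * length (h x)               ∎)
  where
  open ≤-Reasoning
  copies : Factor (apply h (x ∷ β) ++ apply h (x ∷ γ)) w
  copies = factor-++⁻ʳ w (apply h α) (subst (λ u → Factor u w) (apply-++-++ h α (x ∷ β) (x ∷ γ)) factor)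

  |xβ|≤c : length (x ∷ β) ≤ c
  |xβ|≤c = begin
    length (x ∷ β)                 ≤⟨ length-++-≤ˡ (x ∷ β) ⟩
    length (x ∷ β ++ x ∷ γ)        ≤⟨ length-++-≤ʳ (x ∷ β ++ x ∷ γ) {α} ⟩
    length (α ++ x ∷ β ++ x ∷ γ)   ≤⟨ |φ|≤c ⟩
    c                              ∎

∃-longest-image : ∀ {k} (h : Morphism k) {f : Formula} {x} → Any (x ∈_) f →
  ∃ λ y → Any (y ∈_) f × All (All (λ z → length (h z) ≤ length (h y))) f
∃-longest-image h {f} {x} x∈f = argmax (length ∘ h) x (concat f) ,
  ∈-concat⁻ f (argmax-all (length ∘ h) (∈-concat⁺ x∈f) (All.tabulate id)) ,
  concat⁻ (f[xs]≤f[argmax] x (concat f))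

DoubledFormula : Formula → Set
DoubledFormula f = ∀ {x} → Any (x ∈_) f → Any (λ φ → 2 ≤ occ x φ) f

maxLength : Formula → ℕ
maxLength f = max 0 (map length f)

length≤maxLength : ∀ {φ f} → φ ∈ f → length φ ≤ maxLength f
length≤maxLength {f = f} = All.lookup (map⁻ (xs≤max 0 (map length f)))

doubledFormula⇒avoidable : ∀ {f x} → Any (x ∈_) f → DoubledFormula f → Avoidable f
doubledFormula⇒avoidable {f} x∈f doubled with k , w , sparse ← sparse-word (maxLength f) =
  k , w , λ (h , h≢[] , occurs) →
    let y , y∈f , longest = ∃-longest-image h x∈f
        φ , φ∈f , 2≤      = find (doubled y∈f)
    in longest-image-not-repeated (maxLength f) w h sparse h≢[]
         (All.lookup longest φ∈f) (length≤maxLength φ∈f) 2≤ (All.lookup occurs φ∈f)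

DoubledWord : Word → Set
DoubledWord φ = ∀ x → x ∈ φ → 2 ≤ occ x φ

doubledWord⇒avoidable : ∀ {φ} → φ ≢ [] → DoubledWord φ → Avoidable (φ ∷ [])
doubledWord⇒avoidable {[]}    φ≢[] _       = contradiction refl φ≢[]
doubledWord⇒avoidable {_ ∷ _} _    doubled = doubledFormula⇒avoidable (here (here refl)) λ where
  (here x∈φ)  → here (doubled _ x∈φ)
  (there ())

-- Splitting a single fragment

take-∷ʳ : ∀ (A : Var) ψ B → take (length (ψ ∷ʳ B)) (A ∷ ψ ∷ʳ B) ≡ A ∷ ψ
take-∷ʳ A []      B = refl
take-∷ʳ A (C ∷ ψ) B = cong (A ∷_) (take-∷ʳ C ψ B)

splitAt-∷-∷ʳ : ∀ A ψ B → splitAt ((A ∷ ψ ∷ʳ B) ∷ []) zero ≡ (A ∷ ψ) ∷ (ψ ∷ʳ B) ∷ []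
splitAt-∷-∷ʳ A ψ B = cong (λ χ → χ ∷ (ψ ∷ʳ B) ∷ []) (take-∷ʳ A ψ B)

inner-doubled : ∀ {A ψ} → DoubledWord (A ∷ ψ ∷ʳ A) → A ∉ ψ → DoubledWord ψ
inner-doubled {A} {ψ} doubled A∉ψ x x∈ψ = subst (2 ≤_)
  (trans (occ-∷-≢ (ψ ∷ʳ A) x≢A) (occ-∷ʳ-≢ ψ x≢A)) (doubled x (there (∈-++⁺ˡ x∈ψ)))
  where
  x≢A : x ≢ A
  x≢A refl = A∉ψ x∈ψ

split-doubled : ∀ {A ψ B} → DoubledWord (A ∷ ψ ∷ʳ B) → (A ≡ B → A ∈ ψ) →
                DoubledFormula ((A ∷ ψ) ∷ (ψ ∷ʳ B) ∷ [])
split-doubled {A} {ψ} {B} doubled A≡B⇒A∈ψ = λ where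
    (here x∈Aψ)         → in-fragment (doubled _ (∈-++⁺ˡ x∈Aψ))
    (there (here x∈ψB)) → in-fragment (doubled _ (there x∈ψB))
  where
  in-fragment : ∀ {x} → 2 ≤ occ x (A ∷ ψ ∷ʳ B) → Any (λ χ → 2 ≤ occ x χ) ((A ∷ ψ) ∷ (ψ ∷ʳ B) ∷ [])
  in-fragment {x} 2≤ with x ≟ A | x ≟ B
  ... | _        | no x≢B   = here (subst (2 ≤_) (occ-∷ʳ-≢ (A ∷ ψ) x≢B) 2≤)
  ... | no x≢A   | _        = there (here (subst (2 ≤_) (occ-∷-≢ (ψ ∷ʳ B) x≢A) 2≤))
  ... | yes refl | yes refl = here (∈⇒2≤occ-∷ A ψ (A≡B⇒A∈ψ refl))

split-avoidable : ∀ {A ψ B} → ψ ≢ [] → DoubledWord (A ∷ ψ ∷ʳ B) →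
                  Avoidable ((A ∷ ψ) ∷ (ψ ∷ʳ B) ∷ [])
split-avoidable {A} {ψ} {B} ψ≢[] doubled with A ≟ B | A ∈? ψ
... | no A≢B   | _       =
  doubledFormula⇒avoidable (here (here refl)) (split-doubled doubled λ A≡B → contradiction A≡B A≢B)
... | yes _    | yes A∈ψ =
  doubledFormula⇒avoidable (here (here refl)) (split-doubled doubled λ _ → A∈ψ)
... | yes refl | no A∉ψ  = avoidable-infix
  (λ where (here refl) → [] , [ A ] , there (here refl))
  (doubledWord⇒avoidable ψ≢[] (inner-doubled doubled A∉ψ))

minimal⇒square : ∀ {φ} → IsOneFragmentFormula φ → MinimallyAvoidable (φ ∷ []) →
                 ∃ λ A → φ ≡ A ∷ A ∷ []
minimal⇒square {[]}    (φ≢[] , _)    _             = contradiction refl φ≢[]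
minimal⇒square {A ∷ φ} (_ , doubled) (_ , minimal)
  with initLast φ | 2≤occ-∷⇒∈ A φ (doubled A (here refl))
... | []            | ()
... | [] ∷ʳ′ _      | here refl = A , refl
... | (C ∷ ψ) ∷ʳ′ B | _         = contradiction (split-avoidable (λ ()) doubled)
  (subst Unavoidable (splitAt-∷-∷ʳ A (C ∷ ψ) B) (minimal zero))

square-minimal : ∀ A → MinimallyAvoidable ((A ∷ A ∷ []) ∷ [])
square-minimal A = doubledWord⇒avoidable (λ ()) AA-doubled ,
  λ where zero → singletons-unavoidable (A ∷ A ∷ [])
  where
  AA-doubled : DoubledWord (A ∷ A ∷ [])
  AA-doubled x (here refl)         = ∈⇒2≤occ-∷ A [ A ] (here refl)
  AA-doubled x (there (here refl)) = ∈⇒2≤occ-∷ A [ A ] (here refl)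

theorem8 : (φ : Word) → IsOneFragmentFormula φ →
    (MinimallyAvoidable (φ ∷ []) → ∃ λ A → φ ≡ A ∷ A ∷ []) ×
    ((∃ λ A → φ ≡ A ∷ A ∷ []) → MinimallyAvoidable (φ ∷ []))
theorem8 φ one = minimal⇒square one , λ where
  (A , refl) → square-minimal A
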